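{- Let $G=(V,E,w_G)$ be any weighted undirected graph, let $\varepsilon\in(0,1)$, let $H=(V,E_H,w_H)$ be a $(1\pm\varepsilon)$-cut sparsifier of $G$, let $\beta\in(0,1)$ and let $\mathcal T$ be any $\beta$-balanced HC-tree on the vertex set $V$. Then $$(1-\varepsilon)\cdot\beta\cdot C_G(\mathcal T)\;\le\; C_H(\mathcal T)\;\le\;(1+\varepsilon)\cdot\frac{1}{\beta}\cdot C_G(\mathcal T).$$
   Context: Let $G=(V,E,w)$ be an undirected graph with nonnegative edge weights $w$. A hierarchical clustering tree (HC-tree) of $G$ is a rooted tree $\mathcal T$ whose leaves are in bijection with $V$. For a node $z$, $\mathcal T[z]$ is the subtree rooted at $z$ and $\mathrm{leaves}(\mathcal T[z])\subseteq V$ its set of leaves. For $u,v\in V$, $u\vee v$ denotes their lowest common ancestor in $\mathcal T$. The cost of $\mathcal T$ on $G$ is $C_G(\mathcal T)=\sum_{(u,v)\in E} w(u,v)\,|\mathrm{leaves}(\mathcal T[u\vee v])|$. For disjoint $A,B\subseteq V$, $w(A,B)$ denotes the total weight of edges with one endpoint in $A$ and the other in $B$, and $\bar A=V\setminus A$. If $\mathcal T$ is binary and $z$ is an internal node with children $z_1,z_2$, where $|\mathrm{leaves}(\mathcal T[z_1])|\le|\mathrm{leaves}(\mathcal T[z_2])|$, then $\mathrm{cut}(\mathcal T[z]):=(A,B)$ with $A=\mathrm{leaves}(\mathcal T[z_1])$, $B=\mathrm{leaves}(\mathcal T[z_2])$. For $0<\beta<1$, a pair of disjoint sets $(A,B)$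 is $\beta$-balanced if $\max\{|A|,|B|\}\le(1-\beta)|A\cup B|$; a binary HC-tree is $\beta$-balanced if $\mathrm{cut}(\mathcal T[z])$ is $\beta$-balanced for every internal node $z$. A weighted graph $H=(V,E_H,w_H)$ with $E_H\subseteq E$ is a $(1\pm\varepsilon)$-cut sparsifier of $G=(V,E,w_G)$ if for every nonempty $A\subsetneq V$: $(1-\varepsilon)w_G(A,\bar A)\le w_H(A,\bar A)\le(1+\varepsilon)w_G(A,\bar A)$. -}

module Defs where

open import Level using (Level; _⊔_; suc; 0ℓ)
open import Algebra.Bundles using (CommutativeRing)
import Algebra.Definitions as AlgDefs
import Algebra.Definitions.RawMonoid as RawMonoidDefs
open import Data.Bool.Base using (if_then_else_)
open import Data.Fin.Base using (Fin)
import Data.Fin.Base as Fin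
import Data.Fin.Properties as Fin
open import Data.Fin.Subset
  using (Subset; _∈_; _∪_; ∁; ⁅_⁆; Nonempty; _⊂_; ∣_∣) renaming (⊤ to full)
open import Data.Fin.Subset.Properties using (_∈?_)
open import Data.Nat.Base using (ℕ)
import Data.Nat.Base as ℕ
import Data.Nat.Properties as ℕ
open import Data.Product.Base using (_×_; _,_; proj₁; proj₂)
open import Data.Sum.Base using (_⊎_)
open import Data.Tree.Binary using (Tree; leaf; node)
open import Data.Unit.Base using (⊤; tt)
open import Function.Definitions using (Bijective)
open import Relation.Binary.Core using (Rel; _⇒_)
open import Relation.Binary.Definitions using (Decidable; Symmetric)
open import Relation.Binary.Structures using (IsTotalOrder)
import Relation.Binary.Construct.NonStrictToStrict as NonStrictToStrict
open import Relation.Binary.PropositionalEquality.Core using (_≡_)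
open import Relation.Nullary.Decidable.Core using (Dec; does; _×-dec_; _⊎-dec_)
open import Relation.Nullary.Negation.Core using (¬_)

-- The library has no real numbers.  Weights and parameters are taken in an
-- arbitrary ordered field, of which (ℝ, ≤) is an instance.  No completeness or
-- Archimedean property is assumed, so results cover ℝ in particular.

record OrderedField c ℓ₁ ℓ₂ : Set (suc (c ⊔ ℓ₁ ⊔ ℓ₂)) where
  infix 4 _≤_
  field
    commutativeRing : CommutativeRing c ℓ₁
  open CommutativeRing commutativeRing public
  field
    _≤_          : Rel Carrier ℓ₂
    isTotalOrder : IsTotalOrder _≈_ _≤_
    +-monoʳ-≤    : ∀ x {y z} → y ≤ z → x + y ≤ x + z
    *-nonNeg     : ∀ {x y} → 0# ≤ x → 0# ≤ y → 0# ≤ x * y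
    0≉1          : ¬ (0# ≈ 1#)
    invertible   : ∀ x → ¬ (x ≈ 0#) → AlgDefs.Invertible _≈_ 1# _*_ x

  open NonStrictToStrict _≈_ _≤_ public using (_<_)

  infix 9 1/_

  1/_ : ∀ {x} → 0# < x → Carrier
  1/_ {x} (_ , 0≉x) = proj₁ (invertible x (λ x≈0 → 0≉x (sym x≈0)))

  fromℕ : ℕ → Carrier
  fromℕ k = RawMonoidDefs._×_ +-rawMonoid k 1#

BinTree : ℕ → Set
BinTree n = Tree ⊤ (Fin n)

private variable
  n : ℕ
  l r t : BinTree n

-- Positions in a tree.  `here` is the root of the tree it is a position of.
data Node {n : ℕ} : BinTree n → Set where
  here  : Node t
  left  : Node l → Node (node l tt r)
  right : Node r → Node (node l tt r)

data Leaf {n : ℕ} : BinTree n → Set where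
  here  : ∀ {v} → Leaf (leaf v)
  left  : Leaf l → Leaf (node l tt r)
  right : Leaf r → Leaf (node l tt r)

label : (t : BinTree n) → Leaf t → Fin n
label (leaf v)      here      = v
label (node l tt r) (left p)  = label l p
label (node l tt r) (right p) = label r p

infix 25 _[_]

_[_] : (t : BinTree n) → Node t → BinTree n
t             [ here ]    = t
(node l tt r) [ left z ]  = l [ z ]
(node l tt r) [ right z ] = r [ z ]

leaves : BinTree n → Subset n
leaves (leaf v)      = ⁅ v ⁆
leaves (node l tt r) = leaves l ∪ leaves r

-- The longest common prefix of the two paths from the root.
lca : (t : BinTree n) → Leaf t → Leaf t → Node t
lca (leaf _)      here      here      = here
lca (node l tt r) (left p)  (left q)  = left (lca l p q)
lca (node l tt r) (left _)  (right _) = here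
lca (node l tt r) (right _) (left _)  = here
lca (node l tt r) (right p) (right q) = right (lca r p q)

-- Only binary trees: β-balance is defined for no others.
record HCTree (n : ℕ) : Set where
  field
    tree            : BinTree n
    label-bijective : Bijective _≡_ _≡_ (label tree)

  leafOf : Fin n → Leaf tree
  leafOf v = proj₁ (proj₂ label-bijective v)

  infixl 6 _∨_

  _∨_ : Fin n → Fin n → Node tree
  u ∨ v = lca tree (leafOf u) (leafOf v)

-- The cut at an internal node with the given child subtrees; the smaller side
-- comes first.
cut : BinTree n → BinTree n → Subset n × Subset n
cut z₁ z₂ =
  if does (∣ leaves z₁ ∣ ℕ.≤? ∣ leaves z₂ ∣)
  then (leaves z₁ , leaves z₂)
  else (leaves z₂ , leaves z₁)

module Clustering {c ℓ₁ ℓ₂} (F : OrderedField c ℓ₁ ℓ₂) where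

  open OrderedField F

  BalancedPair : Carrier → Subset n × Subset n → Set ℓ₂
  BalancedPair β (A , B) =
    fromℕ (∣ A ∣ ℕ.⊔ ∣ B ∣) ≤ (1# - β) * fromℕ ∣ A ∪ B ∣

  Balanced : Carrier → HCTree n → Set ℓ₂
  Balanced β T =
    ∀ (z : Node tree) {z₁ z₂} → tree [ z ] ≡ node z₁ tt z₂ →
    BalancedPair β (cut z₁ z₂)
    where open HCTree T

  -- Finite simple graphs with nonnegative edge weights.  The value of w on
  -- non-adjacent pairs is irrelevant: it is never used below.
  record WeightedGraph (n : ℕ) : Set (suc 0ℓ ⊔ c ⊔ ℓ₁ ⊔ ℓ₂) where
    field
      Adj      : Rel (Fin n) 0ℓ
      adj?     : Decidable Adj
      adj-sym  : Symmetric Adj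
      no-loops : ∀ {v} → ¬ Adj v v
      w        : Fin n → Fin n → Carrier
      w-sym    : ∀ {u v} → Adj u v → w u v ≈ w v u
      w-nonNeg : ∀ {u v} → Adj u v → 0# ≤ w u v

  ∑ : (Fin n → Carrier) → Carrier
  ∑ = RawMonoidDefs.sum +-rawMonoid

  module _ (G : WeightedGraph n) where
    open WeightedGraph G

    -- Each undirected edge {u , v} is summed once, as the pair with u < v.
    ∑edges : (Fin n → Fin n → Carrier) → Carrier
    ∑edges f = ∑ λ u → ∑ λ v →
      if does (u Fin.<? v ×-dec adj? u v) then f u v else 0#

    Joins : Subset n → Subset n → Fin n → Fin n → Set
    Joins A B u v = (u ∈ A × v ∈ B) ⊎ (u ∈ B × v ∈ A)

    joins? : ∀ A B u v → Dec (Joins A B u v)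
    joins? A B u v =
      (u ∈? A ×-dec v ∈? B) ⊎-dec (u ∈? B ×-dec v ∈? A)

    cutWeight : Subset n → Subset n → Carrier
    cutWeight A B = ∑edges λ u v → if does (joins? A B u v) then w u v else 0#

    cost : HCTree n → Carrier
    cost T = ∑edges λ u v → w u v * fromℕ ∣ leaves (tree [ u ∨ v ]) ∣
      where open HCTree T

  record IsCutSparsifier (ε : Carrier) (H G : WeightedGraph n)
         : Set ℓ₂ where
    field
      edges⊆ : WeightedGraph.Adj H ⇒ WeightedGraph.Adj G
      lower  : ∀ A → Nonempty A → A ⊂ full →
               (1# - ε) * cutWeight G A (∁ A) ≤ cutWeight H A (∁ A)
      upper  : ∀ A → Nonempty A → A ⊂ full →
               cutWeight H A (∁ A) ≤ (1# + ε) * cutWeight G A (∁ A)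

{-# OPTIONS --safe #-}

-- Give each cluster z the weight c_z = |parent z| − |z|, except that a leaf
-- gets the full size of its parent.  The clusters separating two vertices u ≠ v
-- are those on the tree paths from u and from v to just below u ∨ v; along each
-- path the weights telescope to |leaves (T[u ∨ v])|.  Hence
-- 2 C_G(T) = Σ_z c_z w(z, z̄), and a cut sparsifier preserves the cost of every
-- binary tree up to the factors 1 ± ε.  The factors β and 1/β only weaken this,
-- because β < 1 and costs are nonnegative.

module Submission where

open import Defs
open import Data.Nat.Base using (ℕ)
open import Data.Product.Base using (_×_)

open import Data.Bool.Base using (true; false; if_then_else_; _∧_; _∨_)
open import Data.Bool.Properties using (∧-comm; ∨-comm)
open import Data.Fin.Base using (Fin)
import Data.Fin.Base as Fin
import Data.Fin.Properties as Fin
open import Data.Fin.Subset using (Subset; _∈_; _∉_; ∁; ⁅_⁆; Nonempty; _⊂_; ∣_∣)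
  renaming (⊤ to full)
open import Data.Fin.Subset.Properties
open import Data.List.Base using (List; []; _∷_; _++_)
import Data.Nat.Base as ℕ
import Data.Nat.Properties as ℕ
open import Data.Product.Base using (_,_; proj₁; proj₂; ∃)
open import Data.Sum.Base using (_⊎_; inj₁; inj₂; [_,_]′)
open import Data.Tree.Binary using (leaf; node)
open import Data.Unit.Base using (tt)
open import Function.Base using (_∘_)
open import Function.Definitions using (Injective)
open import Relation.Binary.Bundles using (Poset)
open import Relation.Binary.PropositionalEquality as ≡ using (_≡_; _≢_)
open import Relation.Binary.Structures using (IsTotalOrder)
open import Relation.Nullary.Decidable
  using (Dec; yes; no; does; dec-true; dec-false; _×-dec_; _⊎-dec_)
open import Relation.Nullary.Negation using (¬_; contradiction)

private variable
  n : ℕ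
  l r : BinTree n

-- Weighted families of vertex sets and the pairs they separate.

Separates : Subset n → Fin n → Fin n → Set
Separates A u v = (u ∈ A × v ∈ ∁ A) ⊎ (u ∈ ∁ A × v ∈ A)

-- Has the same Boolean value, definitionally, as joins? A (∁ A) u v.
separates? : (A : Subset n) (u v : Fin n) → Dec (Separates A u v)
separates? A u v = (u ∈? A ×-dec v ∈? ∁ A) ⊎-dec (u ∈? ∁ A ×-dec v ∈? A)

separates?-sym : (A : Subset n) (u v : Fin n) →
                 does (separates? A u v) ≡ does (separates? A v u)
separates?-sym A u v = ≡.trans
  (≡.cong₂ _∨_ (∧-comm (does (u ∈? A)) (does (v ∈? ∁ A)))
               (∧-comm (does (u ∈? ∁ A)) (does (v ∈? A))))
  (∨-comm (does (v ∈? ∁ A) ∧ does (u ∈? A)) _)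

¬separates-inside : ∀ {A : Subset n} {u v} → u ∈ A → v ∈ A → ¬ Separates A u v
¬separates-inside u∈A v∈A (inj₁ (_ , v∈∁A)) = x∈∁p⇒x∉p v∈∁A v∈A
¬separates-inside u∈A v∈A (inj₂ (u∈∁A , _)) = x∈∁p⇒x∉p u∈∁A u∈A

¬separates-outside : ∀ {A : Subset n} {u v} → u ∉ A → v ∉ A → ¬ Separates A u v
¬separates-outside u∉A v∉A (inj₁ (u∈A , _)) = u∉A u∈A
¬separates-outside u∉A v∉A (inj₂ (_ , v∈A)) = v∉A v∈A

-- Natural weights keep the tree combinatorics in `ℕ` and become nonnegative coefficients under
-- `fromℕ`. Lists let the families of two subtrees be joined by `++`.
WeightedFamily : ℕ → Set
WeightedFamily n = List (ℕ × Subset n)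

-- This is a nonnegative combination of cut semimetrics: each set `A` contributes `k` times the 0-1
-- distance that it induces.
separation : WeightedFamily n → Fin n → Fin n → ℕ
separation []            u v = 0
separation ((k , A) ∷ L) u v =
  (if does (separates? A u v) then k else 0) ℕ.+ separation L u v

separation-++ : ∀ (L M : WeightedFamily n) u v →
                separation (L ++ M) u v ≡ separation L u v ℕ.+ separation M u v
separation-++ []            M u v = ≡.refl
separation-++ ((k , A) ∷ L) M u v =
  ≡.trans (≡.cong (x ℕ.+_) (separation-++ L M u v)) (≡.sym (ℕ.+-assoc x _ _))
  where x = if does (separates? A u v) then k else 0

separation-sym : ∀ (L : WeightedFamily n) u v → separation L u v ≡ separation L v u
separation-sym []            u v = ≡.refl
separation-sym ((k , A) ∷ L) u v = ≡.cong₂ ℕ._+_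
  (≡.cong (if_then k else 0) (separates?-sym A u v)) (separation-sym L u v)

separation-∷-yes : ∀ {k A} (L : WeightedFamily n) {u v} → Separates A u v →
                   separation ((k , A) ∷ L) u v ≡ k ℕ.+ separation L u v
separation-∷-yes {k = k} {A} L {u} {v} s =
  ≡.cong (λ b → (if b then k else 0) ℕ.+ separation L u v)
         (dec-true (separates? A u v) s)

separation-∷-no : ∀ {k A} (L : WeightedFamily n) {u v} → ¬ Separates A u v →
                  separation ((k , A) ∷ L) u v ≡ separation L u v
separation-∷-no {k = k} {A} L {u} {v} ¬s =
  ≡.cong (λ b → (if b then k else 0) ℕ.+ separation L u v)
         (dec-false (separates? A u v) ¬s)

-- Leaf sets of subtrees and their disjointness.

label∈leaves : (t : BinTree n) (p : Leaf t) → label t p ∈ leaves t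
label∈leaves (leaf v)      here      = x∈⁅x⁆ v
label∈leaves (node l tt r) (left p)  = x∈p∪q⁺ (inj₁ (label∈leaves l p))
label∈leaves (node l tt r) (right p) = x∈p∪q⁺ (inj₂ (label∈leaves r p))

∈leaves⇒label : ∀ (t : BinTree n) {v} → v ∈ leaves t → ∃ λ p → label t p ≡ v
∈leaves⇒label (leaf v) u∈ = here , ≡.sym (x∈⁅y⁆⇒x≡y v u∈)
∈leaves⇒label (node l tt r) v∈ with x∈p∪q⁻ (leaves l) (leaves r) v∈
... | inj₁ v∈l = let p , eq = ∈leaves⇒label l v∈l in left p , eq
... | inj₂ v∈r = let p , eq = ∈leaves⇒label r v∈r in right p , eq

-- Injectivity is the half of `label-bijective` that passes to subtrees, so the inductions on trees
-- carry it alone.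
DistinctLabels : BinTree n → Set
DistinctLabels t = Injective _≡_ _≡_ (label t)

distinctˡ : DistinctLabels (node l tt r) → DistinctLabels l
distinctˡ inj eq with inj {left _} {left _} eq
... | ≡.refl = ≡.refl

distinctʳ : DistinctLabels (node l tt r) → DistinctLabels r
distinctʳ inj eq with inj {right _} {right _} eq
... | ≡.refl = ≡.refl

-- A common vertex would label one leaf on the left and one on the right. Injectivity would identify
-- them, but their paths differ in the first step.
distinct⇒disjoint : DistinctLabels (node l tt r) →
                    ∀ {v} → v ∈ leaves l → v ∉ leaves r
distinct⇒disjoint {l = l} {r} inj v∈l v∈r
  with ∈leaves⇒label l v∈l | ∈leaves⇒label r v∈r
... | p , eq | q , eq′ with inj {left p} {right q} (≡.trans eq (≡.sym eq′))
...   | ()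

-- Cluster weights of a tree and their telescoping sums.

size : BinTree n → ℕ
size t = ∣ leaves t ∣

-- The weights c_z of the clusters of a subtree whose parent has m leaves.
clusters : ℕ → BinTree n → WeightedFamily n
clusters m (leaf v)        = (m , ⁅ v ⁆) ∷ []
clusters m t@(node l tt r) =
  (m ℕ.∸ size t , leaves t) ∷ clusters (size t) l ++ clusters (size t) r

-- Every cluster of `t` is contained in `leaves t`, so it contains neither vertex.
separation-outside : ∀ m (t : BinTree n) {u v} → u ∉ leaves t → v ∉ leaves t →
                     separation (clusters m t) u v ≡ 0
separation-outside m (leaf x) u∉ v∉ = separation-∷-no [] (¬separates-outside u∉ v∉)
separation-outside m t@(node l tt r) {u} {v} u∉ v∉ = begin
  separation (clusters m t) u v
    ≡⟨ separation-∷-no (L ++ R) (¬separates-outside u∉ v∉) ⟩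
  separation (L ++ R) u v
    ≡⟨ separation-++ L R u v ⟩
  separation L u v ℕ.+ separation R u v
    ≡⟨ ≡.cong₂ ℕ._+_
         (separation-outside (size t) l (u∉ ∘ x∈p∪q⁺ ∘ inj₁) (v∉ ∘ x∈p∪q⁺ ∘ inj₁))
         (separation-outside (size t) r (u∉ ∘ x∈p∪q⁺ ∘ inj₂) (v∉ ∘ x∈p∪q⁺ ∘ inj₂)) ⟩
  0 ∎
  where
  open ≡.≡-Reasoning
  L = clusters (size t) l
  R = clusters (size t) r

-- The separating clusters are those containing `u`, one at each node on the path from the root of
-- `t` down to the leaf of `u`. The root contributes `m ∸ size t` and the child containing `u`
-- contributes `size t` by induction. The full weight given to a leaf ends the telescoping without a
-- remainder.
separation-across : ∀ m (t : BinTree n) {u v} → DistinctLabels t → size t ℕ.≤ m →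
                    u ∈ leaves t → v ∉ leaves t →
                    separation (clusters m t) u v ≡ m
separation-across m (leaf x) inj t≤m u∈ v∉ =
  ≡.trans (separation-∷-yes [] (inj₁ (u∈ , x∉p⇒x∈∁p v∉))) (ℕ.+-identityʳ m)
separation-across m t@(node l tt r) {u} {v} inj t≤m u∈ v∉ = begin
  separation (clusters m t) u v
    ≡⟨ separation-∷-yes (L ++ R) (inj₁ (u∈ , x∉p⇒x∈∁p v∉)) ⟩
  m ℕ.∸ size t ℕ.+ separation (L ++ R) u v
    ≡⟨ ≡.cong (m ℕ.∸ size t ℕ.+_) (≡.trans (separation-++ L R u v) below) ⟩
  m ℕ.∸ size t ℕ.+ size t
    -- As `∸` truncates, the two terms add up to `m` only because `size t` is at most `m`.
    ≡⟨ ℕ.m∸n+n≡m t≤m ⟩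
  m ∎
  where
  open ≡.≡-Reasoning
  L = clusters (size t) l
  R = clusters (size t) r
  v∉l = v∉ ∘ x∈p∪q⁺ ∘ inj₁
  v∉r = v∉ ∘ x∈p∪q⁺ ∘ inj₂

  below : separation L u v ℕ.+ separation R u v ≡ size t
  below with x∈p∪q⁻ (leaves l) (leaves r) u∈
  ... | inj₁ u∈l = ≡.trans
    (≡.cong₂ ℕ._+_
      (separation-across (size t) l (distinctˡ inj)
        (∣p∣≤∣p∪q∣ (leaves l) (leaves r)) u∈l v∉l)
      (separation-outside (size t) r (distinct⇒disjoint inj u∈l) v∉r))
    (ℕ.+-identityʳ (size t))
  ... | inj₂ u∈r = ≡.cong₂ ℕ._+_
    (separation-outside (size t) l (λ u∈l → distinct⇒disjoint inj u∈l u∈r) v∉l)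
    (separation-across (size t) r (distinctʳ inj)
      (∣q∣≤∣p∪q∣ (leaves l) (leaves r)) u∈r v∉r)

-- Each child contains exactly one of the two vertices, so `separation-across` yields `s` once on
-- each side. This is where the factor 2 arises. On the right the contained vertex comes second,
-- hence the appeal to symmetry.
separation-split : ∀ (l r : BinTree n) {u v} → DistinctLabels (node l tt r) →
  u ∈ leaves l → v ∈ leaves r →
  let s = size (node l tt r) in
  separation (clusters s l) u v ℕ.+ separation (clusters s r) u v ≡ s ℕ.+ s
separation-split l r {u} {v} inj u∈l v∈r = ≡.cong₂ ℕ._+_
  (separation-across _ l (distinctˡ inj) (∣p∣≤∣p∪q∣ (leaves l) (leaves r)) u∈l
    (λ v∈l → distinct⇒disjoint inj v∈l v∈r))
  (≡.trans (separation-sym (clusters _ r) u v)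
    (separation-across _ r (distinctʳ inj) (∣q∣≤∣p∪q∣ (leaves l) (leaves r)) v∈r
      (distinct⇒disjoint inj u∈l)))

-- The cluster of `t` itself contains both labels and separates nothing, whatever `m` is. If one
-- child contains both leaves, the other contributes 0 and the induction descends. Where the paths
-- part, `separation-split` applies.
separation-lca : ∀ m (t : BinTree n) → DistinctLabels t → ∀ p q → p ≢ q →
  let d = size (t [ lca t p q ]) in
  separation (clusters m t) (label t p) (label t q) ≡ d ℕ.+ d
-- For equal leaves the equation fails: the separation is 0 while `d` is 1.
separation-lca m (leaf v) inj here here p≢q = contradiction ≡.refl p≢q
separation-lca m t@(node l tt r) inj p q p≢q =
  ≡.trans
    (separation-∷-no (L ++ R)
      (¬separates-inside (label∈leaves t p) (label∈leaves t q)))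
    (≡.trans (separation-++ L R (label t p) (label t q)) (below p q p≢q))
  where
  L = clusters (size t) l
  R = clusters (size t) r

  below : ∀ p q → p ≢ q → let d = size (t [ lca t p q ]) in
          separation L (label t p) (label t q) ℕ.+
          separation R (label t p) (label t q) ≡ d ℕ.+ d
  below (left p) (left q) p≢q = ≡.trans
    (≡.cong₂ ℕ._+_
      (separation-lca (size t) l (distinctˡ inj) p q (p≢q ∘ ≡.cong left))
      (separation-outside (size t) r
        (distinct⇒disjoint inj (label∈leaves l p))
        (distinct⇒disjoint inj (label∈leaves l q))))
    (ℕ.+-identityʳ _)
  below (left p) (right q) p≢q =
    separation-split l r inj (label∈leaves l p) (label∈leaves r q)
  below (right p) (left q) p≢q = ≡.trans
    (≡.cong₂ ℕ._+_ (separation-sym L _ _) (separation-sym R _ _))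
    (separation-split l r inj (label∈leaves l q) (label∈leaves r p))
  below (right p) (right q) p≢q = ≡.cong₂ ℕ._+_
    (separation-outside (size t) l
      (λ v∈l → distinct⇒disjoint inj v∈l (label∈leaves r p))
      (λ v∈l → distinct⇒disjoint inj v∈l (label∈leaves r q)))
    (separation-lca (size t) r (distinctʳ inj) p q (p≢q ∘ ≡.cong right))

-- The root has no parent. Its own size stands in for the parent's, which gives an internal root the
-- weight 0.
treeClusters : HCTree n → WeightedFamily n
treeClusters T = clusters (size tree) tree
  where open HCTree T

separation-treeClusters : ∀ (T : HCTree n) {u v} → u ≢ v →
  let open HCTree T using (tree)
      d = size (tree [ HCTree._∨_ T u v ]) in
  separation (treeClusters T) u v ≡ d ℕ.+ d
separation-treeClusters T {u} {v} u≢v =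
  ≡.trans (≡.cong₂ (separation (treeClusters T)) (≡.sym (label-leafOf u))
                                                 (≡.sym (label-leafOf v)))
    (separation-lca (size tree) tree (proj₁ label-bijective) (leafOf u) (leafOf v)
      λ eq → u≢v (≡.trans (≡.sym (label-leafOf u))
                    (≡.trans (≡.cong (label tree) eq) (label-leafOf v))))
  where
  open HCTree T
  label-leafOf : ∀ x → label tree (leafOf x) ≡ x
  label-leafOf x = proj₂ (proj₂ label-bijective x) ≡.refl

-- Order arithmetic in an ordered field.

module OrderedFieldProperties {c ℓ₁ ℓ₂} (F : OrderedField c ℓ₁ ℓ₂) where

  open OrderedField F
  open IsTotalOrder isTotalOrder public
    using (isPartialOrder; total; antisym; ≤-respˡ-≈; ≤-respʳ-≈)
    renaming (refl to ≤-refl; reflexive to ≤-reflexive; trans to ≤-trans)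
  open import Algebra.Properties.Ring ring

  poset : Poset c ℓ₁ ℓ₂
  poset = record { isPartialOrder = isPartialOrder }

  open import Relation.Binary.Reasoning.PartialOrder poset

  +-monoˡ-≤ : ∀ z {x y} → x ≤ y → x + z ≤ y + z
  +-monoˡ-≤ z {x} {y} x≤y = begin
    x + z ≈⟨ +-comm x z ⟩
    z + x ≤⟨ +-monoʳ-≤ z x≤y ⟩
    z + y ≈⟨ +-comm z y ⟩
    y + z ∎

  +-mono-≤ : ∀ {x y u v} → x ≤ y → u ≤ v → x + u ≤ y + v
  +-mono-≤ {y = y} {u} x≤y u≤v = ≤-trans (+-monoˡ-≤ u x≤y) (+-monoʳ-≤ y u≤v)

  +-nonNeg : ∀ {x y} → 0# ≤ x → 0# ≤ y → 0# ≤ x + y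
  +-nonNeg 0≤x 0≤y = ≤-respˡ-≈ (+-identityˡ 0#) (+-mono-≤ 0≤x 0≤y)

  x≤y⇒0≤y-x : ∀ {x y} → x ≤ y → 0# ≤ y - x
  x≤y⇒0≤y-x {x} x≤y = ≤-respˡ-≈ (-‿inverseʳ x) (+-monoˡ-≤ (- x) x≤y)

  0≤y-x⇒x≤y : ∀ {x y} → 0# ≤ y - x → x ≤ y
  0≤y-x⇒x≤y {x} {y} 0≤y-x = begin
    x           ≈⟨ +-identityˡ x ⟨
    0# + x      ≤⟨ +-monoˡ-≤ x 0≤y-x ⟩
    y - x + x   ≈⟨ //-rightDividesˡ x y ⟩
    y           ∎

  +-cancelˡ-≤ : ∀ x {y z} → x + y ≤ x + z → y ≤ z
  +-cancelˡ-≤ x {y} {z} x+y≤x+z = begin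
    y              ≈⟨ \\-leftDividesʳ x y ⟨
    - x + (x + y)  ≤⟨ +-monoʳ-≤ (- x) x+y≤x+z ⟩
    - x + (x + z)  ≈⟨ \\-leftDividesʳ x z ⟩
    z              ∎

  -- By totality only the case `y ≤ x` is left, where `x + x ≤ y + y ≤ x + y` and `x` cancels. This
  -- will remove the factor 2 from the doubled costs.
  x+x≤y+y⇒x≤y : ∀ {x y} → x + x ≤ y + y → x ≤ y
  x+x≤y+y⇒x≤y {x} {y} 2x≤2y with total x y
  ... | inj₁ x≤y = x≤y
  ... | inj₂ y≤x = +-cancelˡ-≤ x (≤-trans 2x≤2y (+-monoˡ-≤ y y≤x))

  *-monoˡ-≤-nonNeg : ∀ {x} → 0# ≤ x → ∀ {y z} → y ≤ z → x * y ≤ x * z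
  *-monoˡ-≤-nonNeg {x} 0≤x {y} {z} y≤z = 0≤y-x⇒x≤y
    (≤-respʳ-≈ (x[y-z]≈xy-xz x z y) (*-nonNeg 0≤x (x≤y⇒0≤y-x y≤z)))

  *-monoʳ-≤-nonNeg : ∀ {x} → 0# ≤ x → ∀ {y z} → y ≤ z → y * x ≤ z * x
  *-monoʳ-≤-nonNeg {x} 0≤x {y} {z} y≤z = begin
    y * x  ≈⟨ *-comm y x ⟩
    x * y  ≤⟨ *-monoˡ-≤-nonNeg 0≤x y≤z ⟩
    x * z  ≈⟨ *-comm x z ⟩
    z * x  ∎

  x≤0⇒0≤-x : ∀ {x} → x ≤ 0# → 0# ≤ - x
  x≤0⇒0≤-x {x} x≤0 = ≤-respʳ-≈ (+-identityˡ (- x)) (x≤y⇒0≤y-x x≤0)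

  0≤1 : 0# ≤ 1#
  0≤1 with total 0# 1#
  ... | inj₁ 0≤1 = 0≤1
  ... | inj₂ 1≤0 = begin
    -- If `1# ≤ 0#`, then `- 1#` is nonnegative, and `1#` is its square.
    0#             ≤⟨ *-nonNeg (x≤0⇒0≤-x 1≤0) (x≤0⇒0≤-x 1≤0) ⟩
    - 1# * - 1#    ≈⟨ -1*x≈-x (- 1#) ⟩
    - - 1#         ≈⟨ -‿involutive 1# ⟩
    1#             ∎

  fromℕ-nonNeg : ∀ k → 0# ≤ fromℕ k
  fromℕ-nonNeg ℕ.zero    = ≤-refl
  fromℕ-nonNeg (ℕ.suc k) = +-nonNeg 0≤1 (fromℕ-nonNeg k)

  *-1/ : ∀ {x} (0<x : 0# < x) → x * 1/ 0<x ≈ 1#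
  *-1/ {x} (_ , 0≉x) = proj₂ (proj₂ (invertible x (λ x≈0 → 0≉x (sym x≈0))))

  1/-nonNeg : ∀ {x} (0<x : 0# < x) → 0# ≤ 1/ 0<x
  1/-nonNeg {x} 0<x with total 0# (1/ 0<x)
  ... | inj₁ 0≤1/x = 0≤1/x
  -- A nonpositive inverse would make `1#`, the product of `x` and its inverse, nonpositive as well.
  ... | inj₂ 1/x≤0 = contradiction (antisym 0≤1 1≤0) 0≉1
    where
    1≤0 : 1# ≤ 0#
    1≤0 = begin
      1#          ≈⟨ *-1/ 0<x ⟨
      x * 1/ 0<x  ≤⟨ *-monoˡ-≤-nonNeg (proj₁ 0<x) 1/x≤0 ⟩
      x * 0#      ≈⟨ zeroʳ x ⟩
      0#          ∎

  x≤1⇒1≤1/x : ∀ {x} (0<x : 0# < x) → x ≤ 1# → 1# ≤ 1/ 0<x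
  x≤1⇒1≤1/x {x} 0<x x≤1 = begin
    1#           ≈⟨ *-1/ 0<x ⟨
    x * 1/ 0<x   ≤⟨ *-monoʳ-≤-nonNeg (1/-nonNeg 0<x) x≤1 ⟩
    1# * 1/ 0<x  ≈⟨ *-identityˡ _ ⟩
    1/ 0<x       ∎

-- Sums over edges and cut weights of families.

module ClusteringProperties {c ℓ₁ ℓ₂} (F : OrderedField c ℓ₁ ℓ₂) where

  open OrderedField F
  open Clustering F
  open OrderedFieldProperties F
  open import Algebra.Properties.Semiring.Sum semiring
    using (sum-cong-≋; ∑-distrib-+; *-distribˡ-sum)
  open import Algebra.Properties.Monoid.Mult +-monoid using (×-homo-+; ×-congˡ)
  open import Algebra.Properties.CommutativeSemigroup *-commutativeSemigroup
    using (x∙yz≈y∙xz)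
  open import Relation.Binary.Reasoning.PartialOrder poset

  ∑-nonNeg : ∀ {n} (f : Fin n → Carrier) → (∀ i → 0# ≤ f i) → 0# ≤ ∑ f
  ∑-nonNeg {ℕ.zero}  f 0≤f = ≤-refl
  ∑-nonNeg {ℕ.suc n} f 0≤f =
    +-nonNeg (0≤f Fin.zero) (∑-nonNeg (f ∘ Fin.suc) (0≤f ∘ Fin.suc))

  -- The equality is required only under `P`, since facts about `w` and about distinct endpoints are
  -- available only on adjacent pairs.
  if-cong : ∀ {p} {P : Set p} (P? : Dec P) {x y} → (P → x ≈ y) →
            (if does P? then x else 0#) ≈ (if does P? then y else 0#)
  if-cong (yes p) x≈y = x≈y p
  if-cong (no _)  x≈y = refl

  if-nonNeg : ∀ {p} {P : Set p} (P? : Dec P) {x} → (P → 0# ≤ x) →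
              0# ≤ (if does P? then x else 0#)
  if-nonNeg (yes p) 0≤x = 0≤x p
  if-nonNeg (no _)  0≤x = ≤-refl

  if-distrib-+ : ∀ b {x y} → (if b then x + y else 0#) ≈
                 (if b then x else 0#) + (if b then y else 0#)
  if-distrib-+ true  = refl
  if-distrib-+ false = sym (+-identityˡ 0#)

  *-distribˡ-if : ∀ b {x y} → x * (if b then y else 0#) ≈ (if b then x * y else 0#)
  *-distribˡ-if true      = refl
  *-distribˡ-if false {x} = zeroʳ x

  module _ (G : WeightedGraph n) where
    open WeightedGraph G

    private
      edge? : ∀ u v → Dec (u Fin.< v × Adj u v)
      edge? u v = u Fin.<? v ×-dec adj? u v

    ∑edges-cong : ∀ {f g} → (∀ {u v} → Adj u v → f u v ≈ g u v) →
                  ∑edges G f ≈ ∑edges G g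
    ∑edges-cong f≈g = sum-cong-≋ λ u → sum-cong-≋ λ v →
      if-cong (edge? u v) (λ e → f≈g (proj₂ e))

    ∑edges-nonNeg : ∀ {f} → (∀ {u v} → Adj u v → 0# ≤ f u v) → 0# ≤ ∑edges G f
    ∑edges-nonNeg 0≤f = ∑-nonNeg _ λ u → ∑-nonNeg _ λ v →
      if-nonNeg (edge? u v) (λ e → 0≤f (proj₂ e))

    ∑edges-+ : ∀ f g → ∑edges G (λ u v → f u v + g u v) ≈ ∑edges G f + ∑edges G g
    ∑edges-+ f g = trans
      (sum-cong-≋ λ u → trans
        (sum-cong-≋ λ v → if-distrib-+ (does (edge? u v)))
        (∑-distrib-+ (λ v → if does (edge? u v) then f u v else 0#) _))
      (∑-distrib-+ (λ u → ∑ λ v → if does (edge? u v) then f u v else 0#) _)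

    *-distribˡ-∑edges : ∀ x f → x * ∑edges G f ≈ ∑edges G (λ u v → x * f u v)
    *-distribˡ-∑edges x f = trans
      (*-distribˡ-sum x (λ u → ∑ λ v → if does (edge? u v) then f u v else 0#))
      (sum-cong-≋ λ u → trans
        (*-distribˡ-sum x (λ v → if does (edge? u v) then f u v else 0#))
        (sum-cong-≋ λ v → *-distribˡ-if (does (edge? u v))))

    ∑edges-0 : ∀ {f} → (∀ {u v} → Adj u v → f u v ≈ 0#) → ∑edges G f ≈ 0#
    ∑edges-0 {f} f≈0 = begin-equality
      -- Writing each zero as `0# * 0#` lets a zero scalar be pulled out of the sum.
      ∑edges G f                 ≈⟨ ∑edges-cong (λ e → trans (f≈0 e) (sym (zeroˡ _))) ⟩
      ∑edges G (λ u v → 0# * 0#) ≈⟨ *-distribˡ-∑edges 0# (λ _ _ → 0#) ⟨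
      0# * ∑edges G (λ _ _ → 0#) ≈⟨ zeroˡ _ ⟩
      0#                         ∎

    -- An edge separated by `A` would have one endpoint in `A` and the other in the complement. This
    -- handles the sets outside the scope of the sparsifier conditions, among them the root cluster.
    cutWeight-trivial : ∀ A → ¬ (Nonempty A × Nonempty (∁ A)) →
                        cutWeight G A (∁ A) ≈ 0#
    cutWeight-trivial A trivial = ∑edges-0 λ {u} {v} _ → reflexive
      (≡.cong (if_then w u v else 0#) (dec-false (separates? A u v)
        [ (λ (u∈A , v∈∁A) → trivial ((u , u∈A) , (v , v∈∁A)))
        , (λ (u∈∁A , v∈A) → trivial ((v , v∈A) , (u , u∈∁A))) ]′))

    familyCutWeight : WeightedFamily n → Carrier
    familyCutWeight []            = 0#
    familyCutWeight ((k , A) ∷ L) = fromℕ k * cutWeight G A (∁ A) + familyCutWeight L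

    -- Exchange of summation: an edge enters the cut of `A` exactly when `A` separates its
    -- endpoints, so in total its weight is multiplied by the weights of all sets separating them.
    familyCutWeight-separation : ∀ L →
      familyCutWeight L ≈ ∑edges G (λ u v → w u v * fromℕ (separation L u v))
    familyCutWeight-separation [] = sym (∑edges-0 (λ _ → zeroʳ _))
    familyCutWeight-separation ((k , A) ∷ L) = begin-equality
      fromℕ k * cutWeight G A (∁ A) + familyCutWeight L
        ≈⟨ +-cong (*-distribˡ-∑edges (fromℕ k) cutEdge) (familyCutWeight-separation L) ⟩
      ∑edges G (λ u v → fromℕ k * cutEdge u v) +
      ∑edges G (λ u v → w u v * fromℕ (separation L u v))
        ≈⟨ ∑edges-+ (λ u v → fromℕ k * cutEdge u v) _ ⟨
      ∑edges G (λ u v → fromℕ k * cutEdge u v + w u v * fromℕ (separation L u v))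
        ≈⟨ ∑edges-cong (λ {u} {v} _ → step (does (separates? A u v))) ⟩
      ∑edges G (λ u v → w u v * fromℕ (separation ((k , A) ∷ L) u v)) ∎
      where
      cutEdge : Fin _ → Fin _ → Carrier
      cutEdge u v = if does (separates? A u v) then w u v else 0#

      step : ∀ b {x s} → fromℕ k * (if b then x else 0#) + x * fromℕ s ≈
                         x * fromℕ ((if b then k else 0) ℕ.+ s)
      step true {x} {s} = begin-equality
        fromℕ k * x + x * fromℕ s  ≈⟨ +-congʳ (*-comm (fromℕ k) x) ⟩
        x * fromℕ k + x * fromℕ s  ≈⟨ distribˡ x (fromℕ k) (fromℕ s) ⟨
        x * (fromℕ k + fromℕ s)    ≈⟨ *-congˡ (×-homo-+ 1# k s) ⟨
        x * fromℕ (k ℕ.+ s)        ∎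
      step false = trans (+-congʳ (zeroʳ _)) (+-identityˡ _)

    cost-familyCutWeight : ∀ T → cost G T + cost G T ≈ familyCutWeight (treeClusters T)
    cost-familyCutWeight T = begin-equality
      cost G T + cost G T
        ≈⟨ ∑edges-+ (λ u v → w u v * fromℕ (d u v)) _ ⟨
      ∑edges G (λ u v → w u v * fromℕ (d u v) + w u v * fromℕ (d u v))
        ≈⟨ ∑edges-cong double ⟩
      ∑edges G (λ u v → w u v * fromℕ (separation (treeClusters T) u v))
        ≈⟨ familyCutWeight-separation (treeClusters T) ⟨
      familyCutWeight (treeClusters T) ∎
      where
      d : Fin _ → Fin _ → ℕ
      d u v = size (HCTree.tree T [ HCTree._∨_ T u v ])

      double : ∀ {u v} → Adj u v →
        w u v * fromℕ (d u v) + w u v * fromℕ (d u v) ≈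
        w u v * fromℕ (separation (treeClusters T) u v)
      double {u} {v} uv = begin-equality
        w u v * fromℕ (d u v) + w u v * fromℕ (d u v)
          ≈⟨ distribˡ (w u v) _ _ ⟨
        w u v * (fromℕ (d u v) + fromℕ (d u v))
          ≈⟨ *-congˡ (×-homo-+ 1# (d u v) (d u v)) ⟨
        w u v * fromℕ (d u v ℕ.+ d u v)
          -- The endpoints are distinct because the graph has no loops.
          ≈⟨ *-congˡ (×-congˡ (separation-treeClusters T λ { ≡.refl → no-loops uv })) ⟨
        w u v * fromℕ (separation (treeClusters T) u v) ∎

    cost-nonNeg : ∀ T → 0# ≤ cost G T
    cost-nonNeg T = ∑edges-nonNeg λ {u} {v} uv →
      *-nonNeg (w-nonNeg uv) (fromℕ-nonNeg (size (HCTree.tree T [ HCTree._∨_ T u v ])))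

  -- Transfer of cut inequalities to costs.

  module _ {a b : Carrier} (G H : WeightedGraph n)
    (cut≤ : ∀ A → Nonempty A → A ⊂ full →
            a * cutWeight G A (∁ A) ≤ b * cutWeight H A (∁ A)) where

    cutWeight-mono : ∀ A → a * cutWeight G A (∁ A) ≤ b * cutWeight H A (∁ A)
    cutWeight-mono A with nonempty? A ×-dec nonempty? (∁ A)
    -- A point of the complement witnesses that the inclusion of `A` in `full` is strict.
    ... | yes (ne , x , x∈∁A) = cut≤ A ne (⊆⊤ , x , ∈⊤ , x∈∁p⇒x∉p x∈∁A)
    ... | no trivial = ≤-reflexive (trans
      (trans (*-congˡ (cutWeight-trivial G A trivial)) (zeroʳ a))
      (sym (trans (*-congˡ (cutWeight-trivial H A trivial)) (zeroʳ b))))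

    -- The family cut weight is linear in the cut weights with coefficients `fromℕ k`, whose
    -- nonnegativity preserves each inequality. The signs of `a` and `b` do not enter.
    familyCutWeight-mono : ∀ L → a * familyCutWeight G L ≤ b * familyCutWeight H L
    familyCutWeight-mono [] = ≤-reflexive (trans (zeroʳ a) (sym (zeroʳ b)))
    familyCutWeight-mono ((k , A) ∷ L) = begin
      a * (fromℕ k * x + familyCutWeight G L)
        ≈⟨ distribute a x _ ⟩
      fromℕ k * (a * x) + a * familyCutWeight G L
        ≤⟨ +-mono-≤ (*-monoˡ-≤-nonNeg (fromℕ-nonNeg k) (cutWeight-mono A))
                    (familyCutWeight-mono L) ⟩
      fromℕ k * (b * y) + b * familyCutWeight H L
        ≈⟨ distribute b y _ ⟨
      b * (fromℕ k * y + familyCutWeight H L) ∎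
      where
      x = cutWeight G A (∁ A)
      y = cutWeight H A (∁ A)

      distribute : ∀ s z t → s * (fromℕ k * z + t) ≈ fromℕ k * (s * z) + s * t
      distribute s z t =
        trans (distribˡ s (fromℕ k * z) t) (+-congʳ (x∙yz≈y∙xz s (fromℕ k) z))

    -- Twice the cost is a family cut weight, and the same family `treeClusters T` serves both
    -- graphs. Having a scalar on each side lets one statement give both sparsifier bounds.
    cost-mono : ∀ T → a * cost G T ≤ b * cost H T
    cost-mono T = x+x≤y+y⇒x≤y (begin
      a * cost G T + a * cost G T            ≈⟨ distribˡ a _ _ ⟨
      a * (cost G T + cost G T)              ≈⟨ *-congˡ (cost-familyCutWeight G T) ⟩
      a * familyCutWeight G (treeClusters T) ≤⟨ familyCutWeight-mono (treeClusters T) ⟩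
      b * familyCutWeight H (treeClusters T) ≈⟨ *-congˡ (cost-familyCutWeight H T) ⟨
      b * (cost H T + cost H T)              ≈⟨ distribˡ b _ _ ⟩
      b * cost H T + b * cost H T            ∎)

  module _ {ε} {H G : WeightedGraph n} (sparsifier : IsCutSparsifier ε H G) where
    open IsCutSparsifier sparsifier

    sparsifier-cost-lower : ∀ T → (1# - ε) * cost G T ≤ cost H T
    sparsifier-cost-lower T = ≤-respʳ-≈ (*-identityˡ _)
      -- Here `a` is `1# - ε` and `b` is `1#`.
      (cost-mono G H
        (λ A ne A⊂ → ≤-respʳ-≈ (sym (*-identityˡ _)) (lower A ne A⊂)) T)

    sparsifier-cost-upper : ∀ T → cost H T ≤ (1# + ε) * cost G T
    sparsifier-cost-upper T = ≤-respˡ-≈ (*-identityˡ _)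
      -- The graphs trade places, with `a` equal to `1#` and `b` equal to `1# + ε`.
      (cost-mono H G
        (λ A ne A⊂ → ≤-respˡ-≈ (sym (*-identityˡ _)) (upper A ne A⊂)) T)

theorem3p1 : ∀ {c ℓ₁ ℓ₂} (F : OrderedField c ℓ₁ ℓ₂) →
    let open OrderedField F
        open Clustering F in
    ∀ {n : ℕ} (G : WeightedGraph n) (ε : Carrier) → 0# < ε → ε < 1# →
    ∀ (H : WeightedGraph n) → IsCutSparsifier ε H G →
    ∀ (β : Carrier) (0<β : 0# < β) → β < 1# →
    ∀ (T : HCTree n) → Balanced β T →
    ((1# - ε) * β * cost G T ≤ cost H T) ×
    (cost H T ≤ (1# + ε) * 1/ 0<β * cost G T)
theorem3p1 F G ε (0≤ε , _) (ε≤1 , _) H sparsifier β 0<β (β≤1 , _) T _ =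
  (begin
    (1# - ε) * β * cost G T
      -- Replacing `β` by `1#` increases the product, since `1# - ε` and the cost are nonnegative.
      ≤⟨ *-monoʳ-≤-nonNeg (cost-nonNeg G T)
           (*-monoˡ-≤-nonNeg (x≤y⇒0≤y-x ε≤1) β≤1) ⟩
    (1# - ε) * 1# * cost G T
      ≈⟨ *-congʳ (*-identityʳ (1# - ε)) ⟩
    (1# - ε) * cost G T
      ≤⟨ sparsifier-cost-lower sparsifier T ⟩
    cost H T ∎) ,
  (begin
    cost H T
      ≤⟨ sparsifier-cost-upper sparsifier T ⟩
    (1# + ε) * cost G T
      ≈⟨ *-congʳ (*-identityʳ (1# + ε)) ⟨
    (1# + ε) * 1# * cost G T
      -- The inserted `1#` is raised to `1/ 0<β`, which is at least `1#` because `β ≤ 1#`.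
      ≤⟨ *-monoʳ-≤-nonNeg (cost-nonNeg G T)
           (*-monoˡ-≤-nonNeg (+-nonNeg 0≤1 0≤ε) (x≤1⇒1≤1/x 0<β β≤1)) ⟩
    (1# + ε) * 1/ 0<β * cost G T ∎)
  where
  open OrderedField F
  open Clustering F
  open OrderedFieldProperties F
  open ClusteringProperties F
  open import Relation.Binary.Reasoning.PartialOrder poset
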